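{- Let $\mathbf{Ext}(\mathcal S)$ denote the lattice of axiomatic extensions of a logic $\mathcal S$. Then (a) $|\mathbf{Ext}(\mathcal{RDPCH})| = 2^{\aleph_0}$; (b) $|\mathbf{Ext}(\mathcal{RPCH}^d)| = 2^{\aleph_0}$; (c) $|\mathbf{Ext}(\mathcal{RDMH})| = 2^{\aleph_0}$.
   Context: Formulas are built from a countably infinite set of propositional variables in the language $\langle \vee,\wedge,\to,\sim,\bot,\top\rangle$ (with $\leftarrow$ in place of $\to$ for $\mathcal{RPCH}^d$). Abbreviations: $\alpha\to_H\beta:=\alpha\to(\alpha\wedge\beta)$; $\alpha\leftrightarrow_H\beta:=(\alpha\to_H\beta)\wedge(\beta\to_H\alpha)$; $\beta^*:=\beta\to\bot$. A Hilbert-style logic is the consequence relation $\Gamma\vdash\varphi$ given by finite derivations using elements of $\Gamma$, substitution instances of axioms, and instances of the rules. An axiomatic extension of a logic $\mathcal S$ is a logic obtained from $\mathcal S$ by adjoining a set of new axioms while keeping the rules of inference the same; extensions are identified when they have the same consequence relation. The logic $\mathcal{DHMSH}$ has axioms: (1) $\alpha\to_H(\alpha\vee\beta)$; (2) $\beta\to_H(\alpha\vee\beta)$; (3) $(\alpha\to_H\gamma)\to_H[(\beta\to_H\gamma)\to_H\{(\alpha\vee\beta)\to_H\gamma\}]$; (4) $(\alpha\wedge\beta)\to_H\alpha$; (5) $(\gamma\to_H\alpha)\to_H[(\gamma\to_H\beta)\to_H(\gamma\to_H(\alpha\wedge\beta))]$; (6) $\top$; (7) $\bot\to_H\alpha$;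 (8) $[(\alpha\wedge\beta)\to_H\gamma]\to_H[\alpha\to_H(\beta\to_H\gamma)]$; (9) $[\alpha\to_H(\beta\to_H\gamma)]\to_H[(\alpha\wedge\beta)\to_H\gamma]$; (10) $(\alpha\to_H\beta)\to_H[(\beta\to_H\alpha)\to_H((\alpha\to\gamma)\to_H(\beta\to\gamma))]$; (11) $(\alpha\to_H\beta)\to_H[(\beta\to_H\alpha)\to_H((\gamma\to\beta)\to_H(\gamma\to\alpha))]$; (12) $\top\to_H\sim\bot$; (13) $\sim\top\to_H\bot$; (14) $\sim(\alpha\wedge\beta)\to_H(\sim\alpha\vee\sim\beta)$; and rules (MP): from $\varphi$ and $\varphi\to_H\gamma$ deduce $\gamma$; (CP): from $\varphi\to_H\gamma$ deduce $\sim\gamma\to_H\sim\varphi$. $\mathcal{RDPCH}$ is the axiomatic extension of $\mathcal{DHMSH}$ by: (15) $(\alpha\wedge\beta)\to\alpha$; (16) $\sim\bot\to_H\top$; (17) $\sim\sim(\alpha\vee\beta)\leftrightarrow_H(\sim\sim\alpha\vee\sim\sim\beta)$; (18) $(\sim\sim\alpha\vee\alpha)\leftrightarrow_H\alpha$; (19) $\alpha\vee\sim\alpha$; ($\mathcal M_1$) $((\alpha\wedge\sim\alpha)\vee(\beta\vee\beta^*))\leftrightarrow_H(\beta\vee\beta^*)$. $\mathcal{RPCH}^d$ is obtained by dualizing the axioms and rules of $\mathcal{RDPCH}$: in every axiom and rule (with abbreviations expanded) interchange $\vee$ and $\wedge$, interchange $\bot$ and $\top$, replace $\to$ by $\leftarrow$,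 and leave $\sim$ unchanged. $\mathcal{RDMH}$ is the axiomatic extension of $\mathcal{DHMSH}$ by (15), (20) $\sim\sim\alpha\leftrightarrow_H\alpha$, and ($\mathcal M_2$) $[\{\alpha\wedge\sim((\sim\alpha)^*)\}\vee(\beta\vee\beta^*)]\leftrightarrow_H(\beta\vee\beta^*)$. -}

module Defs where

open import Level using (0ℓ) renaming (suc to lsuc)
open import Data.Nat.Base using (ℕ)
open import Data.List.Base using (List; []; _∷_; map)
open import Data.List.Membership.Propositional using () renaming (_∈_ to _∈ˡ_)
open import Data.List.Relation.Unary.All using (All; []; _∷_)
open import Data.Product.Base using (∃; _×_; _,_)
open import Data.Sum.Base using (inj₁; inj₂)
open import Function.Bundles using (_⇔_; mk⇔; Equivalence)
open import Relation.Binary.Lattice.Bundles using (Lattice)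
open import Relation.Binary.PropositionalEquality
  using (_≡_; refl; sym; cong; cong₂; subst)
open import Relation.Unary using (Pred; _∈_; _∪_; _∩_; ∅)

-- The language ⟨∨, ∧, →, ∼, ⊥, ⊤⟩ and the one with ← in place of → differ
-- only in the symbol for the conditional, which is the parameter of Formula:
-- φ ⇒ ψ is read φ → ψ in Formula right and φ ← ψ in Formula left.

data Arrow : Set where
  right left : Arrow

infix  9 ∼_
infixr 8 _∧_
infixr 7 _∨_
infixr 6 _⇒_

data Formula (a : Arrow) : Set where
  var  : ℕ → Formula a
  _∨_  : Formula a → Formula a → Formula a
  _∧_  : Formula a → Formula a → Formula a
  _⇒_  : Formula a → Formula a → Formula a
  ∼_   : Formula a → Formula a
  ⊥ ⊤  : Formula a

Substitution : Arrow → Set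
Substitution a = ℕ → Formula a

infixl 10 _[_]

_[_] : ∀ {a} → Formula a → Substitution a → Formula a
var n   [ σ ] = σ n
(φ ∨ ψ) [ σ ] = (φ [ σ ]) ∨ (ψ [ σ ])
(φ ∧ ψ) [ σ ] = (φ [ σ ]) ∧ (ψ [ σ ])
(φ ⇒ ψ) [ σ ] = (φ [ σ ]) ⇒ (ψ [ σ ])
(∼ φ)   [ σ ] = ∼ (φ [ σ ])
⊥       [ σ ] = ⊥
⊤       [ σ ] = ⊤

record Rule (a : Arrow) : Set where
  constructor _⟹_
  field
    premises   : List (Formula a)
    conclusion : Formula a

record Logic (a : Arrow) : Set₁ where
  field
    Axiom   : Pred (Formula a) 0ℓ
    IsARule : Pred (Rule a) 0ℓ

infix 4 _▸_⊢_

data _▸_⊢_ {a : Arrow} (S : Logic a) (Γ : Pred (Formula a) 0ℓ) : Formula a → Set where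
  hypothesis : ∀ {φ} → φ ∈ Γ → S ▸ Γ ⊢ φ
  axiom      : ∀ {φ} → φ ∈ Logic.Axiom S → (σ : Substitution a) → S ▸ Γ ⊢ φ [ σ ]
  rule       : ∀ {r} → r ∈ Logic.IsARule S → (σ : Substitution a) →
               All (λ φ → S ▸ Γ ⊢ φ [ σ ]) (Rule.premises r) →
               S ▸ Γ ⊢ Rule.conclusion r [ σ ]

Theorem : ∀ {a} → Logic a → Pred (Formula a) 0ℓ
Theorem S φ = S ▸ ∅ ⊢ φ

infixl 5 _⊕_

_⊕_ : ∀ {a} → Logic a → Pred (Formula a) 0ℓ → Logic a
S ⊕ A = record { Axiom = Logic.Axiom S ∪ A ; IsARule = Logic.IsARule S }

-- An extension is presented by the axioms adjoined; different presentations of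
-- the same consequence relation are identified by _≈_ below.

record AxiomaticExtension {a : Arrow} (S : Logic a) : Set₁ where
  constructor adjoin
  field
    newAxioms : Pred (Formula a) 0ℓ

  logic : Logic a
  logic = S ⊕ newAxioms

open AxiomaticExtension

module _ {a : Arrow} {S : Logic a} where

  infix 4 _≈_ _≤_

  _≈_ : AxiomaticExtension S → AxiomaticExtension S → Set₁
  E ≈ F = ∀ (Γ : Pred (Formula a) 0ℓ) φ → logic E ▸ Γ ⊢ φ ⇔ logic F ▸ Γ ⊢ φ

  _≤_ : AxiomaticExtension S → AxiomaticExtension S → Set₁
  E ≤ F = ∀ (Γ : Pred (Formula a) 0ℓ) φ → logic E ▸ Γ ⊢ φ → logic F ▸ Γ ⊢ φ

  join : AxiomaticExtension S → AxiomaticExtension S → AxiomaticExtension S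
  join E F = adjoin (newAxioms E ∪ newAxioms F)

  meet : AxiomaticExtension S → AxiomaticExtension S → AxiomaticExtension S
  meet E F = adjoin (Theorem (logic E) ∩ Theorem (logic F))

[]-∘ : ∀ {a} (φ : Formula a) (σ τ : Substitution a) →
       φ [ σ ] [ τ ] ≡ φ [ (λ n → σ n [ τ ]) ]
[]-∘ (var n) σ τ = refl
[]-∘ (φ ∨ ψ) σ τ = cong₂ _∨_ ([]-∘ φ σ τ) ([]-∘ ψ σ τ)
[]-∘ (φ ∧ ψ) σ τ = cong₂ _∧_ ([]-∘ φ σ τ) ([]-∘ ψ σ τ)
[]-∘ (φ ⇒ ψ) σ τ = cong₂ _⇒_ ([]-∘ φ σ τ) ([]-∘ ψ σ τ)
[]-∘ (∼ φ)   σ τ = cong ∼_ ([]-∘ φ σ τ)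
[]-∘ ⊥       σ τ = refl
[]-∘ ⊤       σ τ = refl

[]-var : ∀ {a} (φ : Formula a) → φ [ var ] ≡ φ
[]-var (var n) = refl
[]-var (φ ∨ ψ) = cong₂ _∨_ ([]-var φ) ([]-var ψ)
[]-var (φ ∧ ψ) = cong₂ _∧_ ([]-var φ) ([]-var ψ)
[]-var (φ ⇒ ψ) = cong₂ _⇒_ ([]-var φ) ([]-var ψ)
[]-var (∼ φ)   = cong ∼_ ([]-var φ)
[]-var ⊥       = refl
[]-var ⊤       = refl

module _ {a : Arrow} {S : Logic a} where

  mutual
    theorem-instance : ∀ {Γ φ} → φ ∈ Theorem S → (τ : Substitution a) → S ▸ Γ ⊢ φ [ τ ]
    theorem-instance {Γ} (axiom {φ} p σ) τ =
      subst (S ▸ Γ ⊢_) (sym ([]-∘ φ σ τ)) (axiom p (λ n → σ n [ τ ]))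
    theorem-instance {Γ} (rule {r} p σ ds) τ =
      subst (S ▸ Γ ⊢_) (sym ([]-∘ (Rule.conclusion r) σ τ))
        (rule p (λ n → σ n [ τ ]) (theorem-instances σ τ ds))

    theorem-instances : ∀ {Γ} (σ τ : Substitution a) {φs} →
      All (λ φ → S ▸ ∅ ⊢ φ [ σ ]) φs →
      All (λ φ → S ▸ Γ ⊢ φ [ (λ n → σ n [ τ ]) ]) φs
    theorem-instances         σ τ []                = []
    theorem-instances {Γ} σ τ (_∷_ {x = φ} d ds) =
      subst (S ▸ Γ ⊢_) ([]-∘ φ σ τ) (theorem-instance d τ) ∷ theorem-instances σ τ ds

  axiom-theorem : ∀ {φ} → φ ∈ Logic.Axiom S → φ ∈ Theorem S
  axiom-theorem {φ} p = subst (S ▸ ∅ ⊢_) ([]-var φ) (axiom p var)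

module _ {a : Arrow} {S : Logic a} where

  mutual
    ≤-intro : (E F : AxiomaticExtension S) →
              (∀ {φ} → φ ∈ newAxioms E → φ ∈ Theorem (logic F)) → E ≤ F
    ≤-intro E F h Γ _ (hypothesis p)         = hypothesis p
    ≤-intro E F h Γ _ (axiom (inj₁ p) σ)     = axiom (inj₁ p) σ
    ≤-intro E F h Γ _ (axiom (inj₂ p) σ)     = theorem-instance (h p) σ
    ≤-intro E F h Γ _ (rule p σ ds)          = rule p σ (≤-intros E F h Γ σ ds)

    ≤-intros : (E F : AxiomaticExtension S) →
               (∀ {φ} → φ ∈ newAxioms E → φ ∈ Theorem (logic F)) →
               ∀ Γ (σ : Substitution a) {φs} →
               All (λ φ → logic E ▸ Γ ⊢ φ [ σ ]) φs → All (λ φ → logic F ▸ Γ ⊢ φ [ σ ]) φs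
    ≤-intros E F h Γ σ []       = []
    ≤-intros E F h Γ σ (d ∷ ds) = ≤-intro E F h Γ _ d ∷ ≤-intros E F h Γ σ ds

  newAxiom-theorem : (E : AxiomaticExtension S) →
                     ∀ {φ} → φ ∈ newAxioms E → φ ∈ Theorem (logic E)
  newAxiom-theorem E p = axiom-theorem (inj₂ p)

Ext : ∀ {a} → Logic a → Lattice (lsuc 0ℓ) (lsuc 0ℓ) (lsuc 0ℓ)
Ext S = record
  { Carrier   = AxiomaticExtension S
  ; _≈_       = _≈_
  ; _≤_       = _≤_
  ; _∨_       = join
  ; _∧_       = meet
  ; isLattice = record
    { isPartialOrder = record
      { isPreorder = record
        { isEquivalence = record
          { refl  = λ Γ φ → mk⇔ (λ d → d) (λ d → d)
          ; sym   = λ p Γ φ → mk⇔ (Equivalence.from (p Γ φ)) (Equivalence.to (p Γ φ))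
          ; trans = λ p q Γ φ →
              mk⇔ (λ d → Equivalence.to (q Γ φ) (Equivalence.to (p Γ φ) d))
                  (λ d → Equivalence.from (p Γ φ) (Equivalence.from (q Γ φ) d))
          }
        ; reflexive = λ p Γ φ → Equivalence.to (p Γ φ)
        ; trans     = λ p q Γ φ d → q Γ φ (p Γ φ d)
        }
      ; antisym = λ p q Γ φ → mk⇔ (p Γ φ) (q Γ φ)
      }
    ; supremum = λ E F →
        ≤-intro E (join E F) (λ p → newAxiom-theorem (join E F) (inj₁ p)) ,
        ≤-intro F (join E F) (λ p → newAxiom-theorem (join E F) (inj₂ p)) ,
        λ G p q → ≤-intro (join E F) G
          λ { (inj₁ x) → p ∅ _ (newAxiom-theorem E x)
            ; (inj₂ x) → q ∅ _ (newAxiom-theorem F x) }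
    ; infimum = λ E F →
        ≤-intro (meet E F) E (λ { (d , _) → d }) ,
        ≤-intro (meet E F) F (λ { (_ , d) → d }) ,
        λ G p q → ≤-intro G (meet E F)
          λ x → newAxiom-theorem (meet E F)
            (p ∅ _ (newAxiom-theorem G x) , q ∅ _ (newAxiom-theorem G x))
    }
  }

infixr 6 _⇒H_
infix  5 _⇔H_
infix  9 _*

_⇒H_ : Formula right → Formula right → Formula right
φ ⇒H ψ = φ ⇒ (φ ∧ ψ)

_⇔H_ : Formula right → Formula right → Formula right
φ ⇔H ψ = (φ ⇒H ψ) ∧ (ψ ⇒H φ)

_* : Formula right → Formula right
φ * = φ ⇒ ⊥

-- Axioms and rules are written in the variables α, β, γ; the schemes are their
-- substitution instances.

α β γ : Formula right
α = var 0
β = var 1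
γ = var 2

DHMSH-axioms : List (Formula right)
DHMSH-axioms =
    (α ⇒H (α ∨ β))
  ∷ (β ⇒H (α ∨ β))
  ∷ ((α ⇒H γ) ⇒H ((β ⇒H γ) ⇒H ((α ∨ β) ⇒H γ)))
  ∷ ((α ∧ β) ⇒H α)
  ∷ ((γ ⇒H α) ⇒H ((γ ⇒H β) ⇒H (γ ⇒H (α ∧ β))))
  ∷ ⊤
  ∷ (⊥ ⇒H α)
  ∷ (((α ∧ β) ⇒H γ) ⇒H (α ⇒H (β ⇒H γ)))
  ∷ ((α ⇒H (β ⇒H γ)) ⇒H ((α ∧ β) ⇒H γ))
  ∷ ((α ⇒H β) ⇒H ((β ⇒H α) ⇒H ((α ⇒ γ) ⇒H (β ⇒ γ))))
  ∷ ((α ⇒H β) ⇒H ((β ⇒H α) ⇒H ((γ ⇒ β) ⇒H (γ ⇒ α))))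
  ∷ (⊤ ⇒H (∼ ⊥))
  ∷ ((∼ ⊤) ⇒H ⊥)
  ∷ ((∼ (α ∧ β)) ⇒H ((∼ α) ∨ (∼ β)))
  ∷ []

DHMSH-rules : List (Rule right)
DHMSH-rules =
    ((α ∷ (α ⇒H γ) ∷ []) ⟹ γ)
  ∷ (((α ⇒H γ) ∷ []) ⟹ ((∼ γ) ⇒H (∼ α)))
  ∷ []

DHMSH : Logic right
DHMSH = record { Axiom = _∈ˡ DHMSH-axioms ; IsARule = _∈ˡ DHMSH-rules }

RDPCH-axioms : List (Formula right)
RDPCH-axioms =
    ((α ∧ β) ⇒ α)
  ∷ ((∼ ⊥) ⇒H ⊤)
  ∷ ((∼ (∼ (α ∨ β))) ⇔H ((∼ (∼ α)) ∨ (∼ (∼ β))))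
  ∷ (((∼ (∼ α)) ∨ α) ⇔H α)
  ∷ (α ∨ (∼ α))
  ∷ (((α ∧ (∼ α)) ∨ (β ∨ (β *))) ⇔H (β ∨ (β *)))
  ∷ []

RDPCH : Logic right
RDPCH = DHMSH ⊕ (_∈ˡ RDPCH-axioms)

RDMH-axioms : List (Formula right)
RDMH-axioms =
    ((α ∧ β) ⇒ α)
  ∷ ((∼ (∼ α)) ⇔H α)
  ∷ (((α ∧ (∼ ((∼ α) *))) ∨ (β ∨ (β *))) ⇔H (β ∨ (β *)))
  ∷ []

RDMH : Logic right
RDMH = DHMSH ⊕ (_∈ˡ RDMH-axioms)

dual : Formula right → Formula left
dual (var n) = var n
dual (φ ∨ ψ) = dual φ ∧ dual ψ
dual (φ ∧ ψ) = dual φ ∨ dual ψ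
dual (φ ⇒ ψ) = dual φ ⇒ dual ψ
dual (∼ φ)   = ∼ dual φ
dual ⊥       = ⊤
dual ⊤       = ⊥

dualRule : Rule right → Rule left
dualRule (φs ⟹ ψ) = map dual φs ⟹ dual ψ

dualLogic : Logic right → Logic left
dualLogic S = record
  { Axiom   = λ φ → ∃ λ ψ → ψ ∈ Logic.Axiom S × φ ≡ dual ψ
  ; IsARule = λ r → ∃ λ s → s ∈ Logic.IsARule S × r ≡ dualRule s
  }

RPCHᵈ : Logic left
RPCHᵈ = dualLogic RDPCH

{-# OPTIONS --safe #-}
module Submission where

-- An extension is determined by its theorems, so Ext S embeds in ℕ → Bool; by
-- Cantor–Schröder–Bernstein it suffices to find infinitely many axioms independent over S.
--
-- Kripke frames of height 2 are models: ∼φ holds at x when φ fails at some y ⊑ x (RDPCH), or when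
-- φ fails at the image of x under an antitone involution (RDMH). Take the crowns with elements
-- top i and bot i (i < 3 + n), where bot i lies below top j iff i ≢ j. Two zigzag steps connect
-- all of their top elements, so one formula can quantify over these, and it can say of 3 + n
-- variables that each singles out a top element, that these are distinct and that there are no
-- others. The negation of this fails in the n-th crown and is valid in all the other ones.

open import Defs
  using ( Arrow; right; left; Formula; var; _∨_; _∧_; _⇒_; ∼_; ⊥; ⊤; _[_]; Substitution
        ; _⟹_; Logic; axiom; rule; Theorem; _⊕_
        ; AxiomaticExtension; adjoin; ≤-intro; newAxiom-theorem
        ; Ext; _*; DHMSH; DHMSH-axioms; RDPCH-axioms; RDPCH; RDMH-axioms; RDMH
        ; dual; dualLogic; RPCHᵈ)
open import Level using (Level; 0ℓ; suc; _⊔_; Lift; lift; lower)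
open import Axiom.ExcludedMiddle using (ExcludedMiddle)
open import Axiom.DoubleNegationElimination using (DoubleNegationElimination; em⇒dne)
open import Data.Bool.Base using (Bool; true; false)
open import Data.Empty using (⊥-elim) renaming (⊥ to Empty)
open import Data.Fin.Base using (Fin; zero; toℕ; punchIn; punchOut) renaming (suc to fsuc)
open import Data.Fin.Properties
  using (toℕ-injective; punchInᵢ≢i; punchIn-punchOut; injective⇒≤) renaming (_≟_ to _≟ᶠ_)
open import Data.List.Base using (List; []; _∷_; map)
open import Data.List.Relation.Unary.All using (All; []; _∷_; lookup)
open import Data.List.Relation.Unary.Any using (here; there)
open import Data.Nat.Base using (ℕ; zero; _+_) renaming (suc to nsuc)
open import Data.Nat.Binary.Base using (ℕᵇ; zero; 2[1+_]; 1+[2_]; fromℕ) renaming (toℕ to toℕᵇ)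
open import Data.Nat.Binary.Properties using (fromℕ-toℕ)
open import Data.Nat.Properties using (+-suc; +-identityʳ; +-cancelˡ-≡; ≤-antisym)
open import Data.Product.Base using (∃; _×_; _,_; proj₁; proj₂) renaming (map to map-×)
open import Data.Sum.Base using (_⊎_; inj₁; inj₂; [_,_]′) renaming (map to map-⊎)
open import Data.Unit.Base using (tt) renaming (⊤ to Unit)
open import Function.Base using (_∘_; id)
open import Function.Bundles using (Bijection; Injection; _⇔_; mk⇔; Equivalence)
open import Relation.Binary.Bundles using (Setoid)
open import Relation.Binary.Lattice.Bundles using (module Lattice)
open import Relation.Binary.PropositionalEquality
  using (_≡_; _≢_; refl; sym; trans; cong; cong₂; subst; _→-setoid_)
open import Relation.Nullary using (Dec; yes; no; ¬_; does; contradiction)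
open import Relation.Nullary.Decidable using (map′; does-⇔; dec-true)
open import Relation.Unary using (Pred; _∈_; ∅)

open Equivalence using (to; from)

lowerEM : ∀ {a} b → ExcludedMiddle (a ⊔ b) → ExcludedMiddle a
lowerEM b em {P} = map′ lower lift (em {Lift b P})

-- Cantor–Schröder–Bernstein

module _ {a ℓ₁ b ℓ₂} {A : Setoid a ℓ₁} {B : Setoid b ℓ₂}
         (em : ExcludedMiddle (a ⊔ ℓ₁ ⊔ b)) where

  private
    module A = Setoid A
    module B = Setoid B

  module _ (F : Injection A B) (G : Injection B A) where

    private
      module F = Injection F
      module G = Injection G

    -- x descends, through alternating preimages, from an element of A outside the image of G.
    data FromA (x : A.Carrier) : Set (a ⊔ ℓ₁ ⊔ b) where
      start : ¬ (∃ λ y → G.to y A.≈ x) → FromA x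
      step  : ∀ {w} → FromA w → G.to (F.to w) A.≈ x → FromA x

    FromA-resp : ∀ {x y} → x A.≈ y → FromA x → FromA y
    FromA-resp x≈y (start n)  = start λ (z , e) → n (z , A.trans e (A.sym x≈y))
    FromA-resp x≈y (step c e) = step c (A.trans e x≈y)

    preimage : ∀ {x} → ¬ FromA x → ∃ λ y → G.to y A.≈ x
    preimage {x} ¬c = em⇒dne (lowerEM (a ⊔ ℓ₁ ⊔ b) em) (¬c ∘ start)

    -- The decision is an argument rather than a call to `em`, so that `h-cong` and `h-injective`
    -- can compare values under any two decisions.
    h : ∀ {x} → Dec (FromA x) → B.Carrier
    h {x} (yes _)  = F.to x
    h     (no ¬c)  = proj₁ (preimage ¬c)

    h-cong : ∀ {x y} (c : Dec (FromA x)) (d : Dec (FromA y)) → x A.≈ y → h c B.≈ h d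
    h-cong (yes _) (yes _) e = F.cong e
    h-cong (yes c) (no ¬d) e = contradiction (FromA-resp e c) ¬d
    h-cong (no ¬c) (yes d) e = contradiction (FromA-resp (A.sym e) d) ¬c
    h-cong (no ¬c) (no ¬d) e =
      G.injective (A.trans (proj₂ (preimage ¬c)) (A.trans e (A.sym (proj₂ (preimage ¬d)))))

    h-injective : ∀ {x y} (c : Dec (FromA x)) (d : Dec (FromA y)) → h c B.≈ h d → x A.≈ y
    h-injective (yes _) (yes _) e = F.injective e
    h-injective (yes c) (no ¬d) e =
      contradiction (step c (A.trans (G.cong e) (proj₂ (preimage ¬d)))) ¬d
    h-injective (no ¬c) (yes d) e =
      contradiction (step d (A.trans (G.cong (B.sym e)) (proj₂ (preimage ¬c)))) ¬c
    h-injective (no ¬c) (no ¬d) e =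
      A.trans (A.sym (proj₂ (preimage ¬c))) (A.trans (G.cong e) (proj₂ (preimage ¬d)))

    h-surjective : ∀ y → Dec (FromA (G.to y)) → ∃ λ x → ∀ {z} → z A.≈ x → h (em {FromA z}) B.≈ y
    h-surjective y (yes (start n))  = contradiction (y , A.refl) n
    -- Since `G.to y` lies in the image of `G`, its chain does not start there; its predecessor `w`
    -- is sent to `y` by `F`.
    h-surjective y (yes (step {w} c e)) =
      w , λ z≈w → B.trans (h-cong em (yes c) z≈w) (G.injective e)
    h-surjective y (no ¬c) =
      G.to y , λ z≈ → B.trans (h-cong em (no ¬c) z≈) (G.injective (proj₂ (preimage ¬c)))

    mutualInjections⇒bijection : Bijection A B
    mutualInjections⇒bijection = record
      { to = λ x → h (em {FromA x})
      ; cong = h-cong em em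
      ; bijective = h-injective em em , λ y → h-surjective y em
      }

-- Enumeration of formulas

module _ {a : Arrow} where

  push : ℕ → ℕᵇ → ℕᵇ
  push zero     b = 1+[2 b ]
  push (nsuc n) b = 2[1+ push n b ]

  -- Reverse Polish notation, a token n being written as n digits 2[1+_] closed by a 1+[2_].
  code : Formula a → ℕᵇ → ℕᵇ
  code ⊥       = push 0
  code ⊤       = push 1
  code (∼ φ)   = code φ ∘ push 2
  code (φ ∨ ψ) = code φ ∘ code ψ ∘ push 3
  code (φ ∧ ψ) = code φ ∘ code ψ ∘ push 4
  code (φ ⇒ ψ) = code φ ∘ code ψ ∘ push 5
  code (var n) = push (6 + n)

  execute : ℕ → List (Formula a) → List (Formula a)
  execute 0 s           = ⊥ ∷ s
  execute 1 s           = ⊤ ∷ s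
  execute 2 (φ ∷ s)     = (∼ φ) ∷ s
  execute 3 (ψ ∷ φ ∷ s) = (φ ∨ ψ) ∷ s
  execute 4 (ψ ∷ φ ∷ s) = (φ ∧ ψ) ∷ s
  execute 5 (ψ ∷ φ ∷ s) = (φ ⇒ ψ) ∷ s
  execute (nsuc (nsuc (nsuc (nsuc (nsuc (nsuc n)))))) s = var n ∷ s
  -- Reached only when an operator finds too few operands, which never happens while a `code φ` is
  -- read.
  execute _ s           = s

  -- The second argument counts the digits read so far of the current token.
  run : ℕᵇ → ℕ → List (Formula a) → List (Formula a)
  run zero     n s = s
  run 2[1+ b ] n s = run b (nsuc n) s
  run 1+[2 b ] n s = run b 0 (execute n s)

  run-push : ∀ n {m b s} → run (push n b) m s ≡ run b 0 (execute (n + m) s)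
  run-push zero             = refl
  run-push (nsuc n) {m} {b} {s} =
    trans (run-push n) (cong (λ k → run b 0 (execute k s)) (+-suc n m))

  run-code : ∀ φ {b s} → run (code φ b) 0 s ≡ run b 0 (φ ∷ s)
  run-code (var n) {b} {s} =
    trans (run-push (6 + n)) (cong (λ k → run b 0 (execute (6 + k) s)) (+-identityʳ n))
  run-code (φ ∨ ψ) = trans (run-code φ) (run-code ψ)
  run-code (φ ∧ ψ) = trans (run-code φ) (run-code ψ)
  run-code (φ ⇒ ψ) = trans (run-code φ) (run-code ψ)
  run-code (∼ φ)   = run-code φ
  run-code ⊥       = refl
  run-code ⊤       = refl

  head⊥ : List (Formula a) → Formula a
  head⊥ []      = ⊥
  head⊥ (φ ∷ _) = φ

  enumerate : ℕ → Formula a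
  enumerate n = head⊥ (run (fromℕ n) 0 [])

  index : Formula a → ℕ
  index φ = toℕᵇ (code φ zero)

  enumerate-index : ∀ φ → enumerate (index φ) ≡ φ
  enumerate-index φ =
    cong head⊥ (trans (cong (λ b → run b 0 []) (fromℕ-toℕ (code φ zero))) (run-code φ))

-- Independent axioms

module _ (em : ExcludedMiddle (suc 0ℓ)) {a : Arrow} {S : Logic a} where

  private
    em₀ : ExcludedMiddle 0ℓ
    em₀ = lowerEM (suc 0ℓ) em

    does≡true⇒ : ∀ {P : Set} (P? : Dec P) → does P? ≡ true → P
    does≡true⇒ (yes p) _ = p

  open AxiomaticExtension using (logic)

  -- The set of theorems determines an extension: if `E` and `F` share their theorems, the axioms
  -- adjoined in `E` are theorems of `F`, and `≤-intro` asks for no more.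
  theorems : Injection (Lattice.setoid (Ext S)) (ℕ →-setoid Bool)
  theorems = record
    { to        = λ E n → does (em₀ {enumerate n ∈ Theorem (logic E)})
    ; cong      = λ E≈F n → does-⇔ (E≈F ∅ (enumerate n)) em₀ em₀
    ; injective = λ {E} {F} e Γ φ →
        mk⇔ (≤-intro E F (λ p → transfer e (newAxiom-theorem E p)) Γ φ)
            (≤-intro F E (λ p → transfer (sym ∘ e) (newAxiom-theorem F p)) Γ φ)
    }
    where
    transfer : ∀ {L M : Logic a} →
      (∀ n → does (em₀ {enumerate n ∈ Theorem L}) ≡ does (em₀ {enumerate n ∈ Theorem M})) →
      ∀ {φ} → φ ∈ Theorem L → φ ∈ Theorem M
    transfer {L} {M} e {φ} d =
      subst (_∈ Theorem M) (enumerate-index φ)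
        (does≡true⇒ em₀ (trans (sym (e (index φ)))
          (dec-true em₀ (subst (_∈ Theorem L) (sym (enumerate-index φ)) d))))

  selected : (ℕ → Formula a) → (ℕ → Bool) → Pred (Formula a) 0ℓ
  selected χ X φ = ∃ λ n → X n ≡ true × φ ≡ χ n

  Independent : (ℕ → Formula a) → Set
  Independent χ = ∀ X m → χ m ∈ Theorem (S ⊕ selected χ X) → X m ≡ true

  -- X is recovered from the extension by `selected χ X` as the set of all m for which `χ m` is a
  -- theorem.
  independent⇒continuum : ∀ χ → Independent χ →
    Bijection (Lattice.setoid (Ext S)) (ℕ →-setoid Bool)
  independent⇒continuum χ independent = mutualInjections⇒bijection em theorems record
    { to        = λ X → adjoin (selected χ X)
    ; cong      = λ X≗Y Γ φ → mk⇔ (mono (λ n → trans (sym (X≗Y n))) Γ φ)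
                                  (mono (λ n → trans (X≗Y n)) Γ φ)
    ; injective = λ {X} {Y} e m →
        ⇔⇒≡ (λ t → independent Y m (to (e ∅ (χ m)) (member X t)))
            (λ t → independent X m (from (e ∅ (χ m)) (member Y t)))
    }
    where
    member : ∀ X {m} → X m ≡ true → χ m ∈ Theorem (S ⊕ selected χ X)
    member X {m} t = newAxiom-theorem (adjoin (selected χ X)) (m , t , refl)

    mono : ∀ {X Y} → (∀ n → X n ≡ true → Y n ≡ true) →
           Lattice._≤_ (Ext S) (adjoin (selected χ X)) (adjoin (selected χ Y))
    mono {X} {Y} X⊆Y = ≤-intro (adjoin (selected χ X)) (adjoin (selected χ Y))
      λ { (n , t , refl) → member Y (X⊆Y n t) }

    ⇔⇒≡ : ∀ {x y} → (x ≡ true → y ≡ true) → (y ≡ true → x ≡ true) → x ≡ y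
    ⇔⇒≡ {true}          f g = sym (f refl)
    ⇔⇒≡ {false} {true}  f g = g refl
    ⇔⇒≡ {false} {false} f g = refl

-- Duality

undual : Formula left → Formula right
undual (var n) = var n
undual (φ ∨ ψ) = undual φ ∧ undual ψ
undual (φ ∧ ψ) = undual φ ∨ undual ψ
undual (φ ⇒ ψ) = undual φ ⇒ undual ψ
undual (∼ φ)   = ∼ undual φ
undual ⊥       = ⊤
undual ⊤       = ⊥

undual-instance : ∀ φ (σ : Substitution left) → undual (dual φ [ σ ]) ≡ φ [ undual ∘ σ ]
undual-instance (var n) σ = refl
undual-instance (φ ∨ ψ) σ = cong₂ _∨_ (undual-instance φ σ) (undual-instance ψ σ)
undual-instance (φ ∧ ψ) σ = cong₂ _∧_ (undual-instance φ σ) (undual-instance ψ σ)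
undual-instance (φ ⇒ ψ) σ = cong₂ _⇒_ (undual-instance φ σ) (undual-instance ψ σ)
undual-instance (∼ φ)   σ = cong ∼_ (undual-instance φ σ)
undual-instance ⊥       σ = refl
undual-instance ⊤       σ = refl

undual-dual : ∀ φ → undual (dual φ) ≡ φ
undual-dual (var n) = refl
undual-dual (φ ∨ ψ) = cong₂ _∨_ (undual-dual φ) (undual-dual ψ)
undual-dual (φ ∧ ψ) = cong₂ _∧_ (undual-dual φ) (undual-dual ψ)
undual-dual (φ ⇒ ψ) = cong₂ _⇒_ (undual-dual φ) (undual-dual ψ)
undual-dual (∼ φ)   = cong ∼_ (undual-dual φ)
undual-dual ⊥       = refl
undual-dual ⊤       = refl

module _ {S : Logic right} {T : Logic left}
         (axioms : ∀ {φ} → φ ∈ Logic.Axiom T → φ ∈ Logic.Axiom (dualLogic S))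
         (rules  : ∀ {r} → r ∈ Logic.IsARule T → r ∈ Logic.IsARule (dualLogic S)) where

  mutual
    -- Derivations are translated back step by step. `T` need only have its axioms and rules among
    -- those of `dualLogic S`, because a dual logic extended by dual axioms is not literally of the
    -- form `dualLogic S`.
    undual-theorem : ∀ {φ} → φ ∈ Theorem T → undual φ ∈ Theorem S
    undual-theorem (axiom p σ) with axioms p
    ... | ψ , q , refl =
      subst (_∈ Theorem S) (sym (undual-instance ψ σ)) (axiom q (undual ∘ σ))
    undual-theorem (rule p σ ds) with rules p
    ... | (φs ⟹ ψ) , q , refl =
      subst (_∈ Theorem S) (sym (undual-instance ψ σ)) (rule q (undual ∘ σ) (undual-theorems φs σ ds))

    undual-theorems : ∀ φs σ → All (λ φ → φ [ σ ] ∈ Theorem T) (map dual φs) →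
                      All (λ φ → φ [ undual ∘ σ ] ∈ Theorem S) φs
    undual-theorems []       σ []       = []
    undual-theorems (φ ∷ φs) σ (d ∷ ds) =
      subst (_∈ Theorem S) (undual-instance φ σ) (undual-theorem d) ∷ undual-theorems φs σ ds

dual-independent : (em : ExcludedMiddle (suc 0ℓ)) {S : Logic right} {χ : ℕ → Formula right} →
  Independent em {S = S} χ → Independent em {S = dualLogic S} (dual ∘ χ)
dual-independent em {S} {χ} independent X m d =
  independent X m (subst (_∈ Theorem (S ⊕ selected em {S = S} χ X)) (undual-dual (χ m))
    (undual-theorem
      (λ { (inj₁ (ψ , p , e)) → ψ , inj₁ p , e
         ; (inj₂ (n , t , e)) → χ n , inj₂ (n , t , refl) , e })
      id d))

-- Kripke semantics

-- What soundness of `DHMSH` asks of `∼`: `antitone` validates contraposition, `persistent` keeps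
-- truth sets upward closed, and the last three fields validate the axioms on `∼ ⊥`, `∼ ⊤` and
-- `∼ (α ∧ β)`.
record Negation {W : Set} (_⊑_ : W → W → Set) : Set₁ where
  field
    neg        : (W → Set) → W → Set
    antitone   : ∀ {P Q : W → Set} → (∀ {x} → P x → Q x) → ∀ {x} → neg Q x → neg P x
    persistent : ∀ {P : W → Set} → (∀ {x y} → x ⊑ y → P x → P y) →
                 ∀ {x y} → x ⊑ y → neg P x → neg P y
    neg-∅      : ∀ {x} → neg (λ _ → Empty) x
    neg-U      : ∀ {x} → ¬ neg (λ _ → Unit) x
    neg-∩      : ∀ {P Q : W → Set} {x} → neg (λ y → P y × Q y) x → neg P x ⊎ neg Q x

module Kripke {W : Set} {_⊑_ : W → W → Set} (⊑-refl : ∀ {x} → x ⊑ x)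
              (⊑-trans : ∀ {x y z} → x ⊑ y → y ⊑ z → x ⊑ z) (N : Negation _⊑_) where

  private
    module N = Negation N

  ⟦_⟧ : Formula right → (ℕ → W → Set) → W → Set
  ⟦ var n ⟧ v x = v n x
  ⟦ φ ∨ ψ ⟧ v x = ⟦ φ ⟧ v x ⊎ ⟦ ψ ⟧ v x
  ⟦ φ ∧ ψ ⟧ v x = ⟦ φ ⟧ v x × ⟦ ψ ⟧ v x
  ⟦ φ ⇒ ψ ⟧ v x = ∀ {y} → x ⊑ y → ⟦ φ ⟧ v y → ⟦ ψ ⟧ v y
  ⟦ ∼ φ ⟧   v x = N.neg (⟦ φ ⟧ v) x
  ⟦ ⊥ ⟧     v x = Empty
  ⟦ ⊤ ⟧     v x = Unit

  Persistent : (ℕ → W → Set) → Set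
  Persistent v = ∀ n {x y} → x ⊑ y → v n x → v n y

  persistent : ∀ {v} → Persistent v → ∀ φ {x y} → x ⊑ y → ⟦ φ ⟧ v x → ⟦ φ ⟧ v y
  persistent up (var n) p = up n p
  persistent up (φ ∨ ψ) p = map-⊎ (persistent up φ p) (persistent up ψ p)
  persistent up (φ ∧ ψ) p (a , b) = persistent up φ p a , persistent up ψ p b
  persistent up (φ ⇒ ψ) p f q = f (⊑-trans p q)
  persistent up (∼ φ)   p = N.persistent (persistent up φ) p
  persistent up ⊤       p = id

  ⟦[]⟧ : ∀ φ σ {v} {x} → ⟦ φ [ σ ] ⟧ v x ⇔ ⟦ φ ⟧ (λ n → ⟦ σ n ⟧ v) x
  ⟦[]⟧ (var n) σ = mk⇔ id id
  ⟦[]⟧ (φ ∨ ψ) σ {v} = mk⇔ (map-⊎ (to (⟦[]⟧ φ σ {v})) (to (⟦[]⟧ ψ σ {v})))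
                           (map-⊎ (from (⟦[]⟧ φ σ {v})) (from (⟦[]⟧ ψ σ {v})))
  ⟦[]⟧ (φ ∧ ψ) σ {v} = mk⇔ (map-× (to (⟦[]⟧ φ σ {v})) (to (⟦[]⟧ ψ σ {v})))
                           (map-× (from (⟦[]⟧ φ σ {v})) (from (⟦[]⟧ ψ σ {v})))
  ⟦[]⟧ (φ ⇒ ψ) σ {v} =
    mk⇔ (λ f {y} p a → to (⟦[]⟧ ψ σ {v} {y}) (f p (from (⟦[]⟧ φ σ {v} {y}) a)))
        (λ f {y} p a → from (⟦[]⟧ ψ σ {v} {y}) (f p (to (⟦[]⟧ φ σ {v} {y}) a)))
  ⟦[]⟧ (∼ φ)   σ {v} = mk⇔ (N.antitone (from (⟦[]⟧ φ σ {v}))) (N.antitone (to (⟦[]⟧ φ σ {v})))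
  ⟦[]⟧ ⊥       σ = mk⇔ id id
  ⟦[]⟧ ⊤       σ = mk⇔ id id

  module _ {v} (up : Persistent v) where

    InstancesHold : Pred (Formula right) 0ℓ
    InstancesHold φ = ∀ σ {x} → ⟦ φ [ σ ] ⟧ v x

    -- Since `⇒` is intuitionistic implication, `φ ⇒H ψ` amounts to `φ ⇒ ψ`; each witness returns
    -- its argument paired with the consequent.
    DHMSH-sound : All InstancesHold DHMSH-axioms
    DHMSH-sound =
        (λ σ p a → a , inj₁ a)
      ∷ (λ σ p b → b , inj₂ b)
      ∷ (λ σ p f → f , λ q g → g , λ r →
          λ { (inj₁ a) → inj₁ a , proj₂ (f (⊑-trans q r) a)
            ; (inj₂ b) → inj₂ b , proj₂ (g r b) })
      ∷ (λ σ p c → c , proj₁ c)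
      ∷ (λ σ p f → f , λ q g → g , λ r c → c , proj₂ (f (⊑-trans q r) c) , proj₂ (g r c))
      ∷ (λ σ → tt)
      ∷ (λ σ p ())
      ∷ (λ σ p f → f , λ q a → a , λ r b → b , proj₂ (f (⊑-trans q r) (persistent up (σ 0) r a , b)))
      ∷ (λ σ p f → f , λ q c → c , proj₂ (proj₂ (f q (proj₁ c)) ⊑-refl (proj₂ c)))
      ∷ (λ σ p f → f , λ q g → g , λ r h → h , λ s b → h s (proj₂ (g (⊑-trans r s) b)))
      ∷ (λ σ p f → f , λ q g → g , λ r h → h , λ s c → proj₂ (g (⊑-trans r s) (h s c)))
      ∷ (λ σ p _ → tt , N.neg-∅)
      ∷ (λ σ p n → n , N.neg-U n)
      ∷ (λ σ p n → n , N.neg-∩ n)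
      ∷ []

    sound : ∀ {A B} → (∀ {φ} → φ ∈ A → InstancesHold φ) → (∀ {φ} → φ ∈ B → InstancesHold φ) →
            ∀ {φ} → φ ∈ Theorem (DHMSH ⊕ A ⊕ B) → ∀ {x} → ⟦ φ ⟧ v x
    sound hA hB (axiom (inj₁ (inj₁ p)) σ) = lookup DHMSH-sound p σ
    sound hA hB (axiom (inj₁ (inj₂ p)) σ) = hA p σ
    sound hA hB (axiom (inj₂ p) σ)        = hB p σ
    sound hA hB (rule (here refl) σ (d ∷ e ∷ [])) =
      proj₂ (sound hA hB e ⊑-refl (sound hA hB d))
    -- The premise is a theorem and so holds at every world, as `antitone` demands.
    sound hA hB (rule (there (here refl)) σ (d ∷ [])) p n =
      n , N.antitone (λ a → proj₂ (sound hA hB d ⊑-refl a)) n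

-- Crowns

data World (k : ℕ) : Set where
  top bot : Fin (3 + k) → World k

infix 4 _⊑_

data _⊑_ {k} : World k → World k → Set where
  ⊑-refl : ∀ {x} → x ⊑ x
  edge   : ∀ {i j} → i ≢ j → bot i ⊑ top j

module _ {k : ℕ} where

  ⊑-trans : {x y z : World k} → x ⊑ y → y ⊑ z → x ⊑ z
  ⊑-trans ⊑-refl   q      = q
  ⊑-trans (edge n) ⊑-refl = edge n

  -- This is where three indices are used: `bot i` lies below both `top s` and `top t`, so any two
  -- tops have a common lower bound.
  avoid : ∀ (s t : Fin (3 + k)) → ∃ λ i → i ≢ s × i ≢ t
  avoid zero            zero            = fsuc zero , (λ ()) , (λ ())
  avoid zero            (fsuc zero)     = fsuc (fsuc zero) , (λ ()) , (λ ())
  avoid zero            (fsuc (fsuc _)) = fsuc zero , (λ ()) , (λ ())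
  avoid (fsuc zero)     zero            = fsuc (fsuc zero) , (λ ()) , (λ ())
  avoid (fsuc (fsuc _)) zero            = fsuc zero , (λ ()) , (λ ())
  avoid (fsuc _)        (fsuc _)        = zero , (λ ()) , (λ ())

  topAbove : ∀ (x : World k) → ∃ λ t → x ⊑ top t
  topAbove (top i) = i , ⊑-refl
  topAbove (bot i) = let j , j≢i , _ = avoid i i in j , edge (j≢i ∘ sym)

  botBelow : ∀ (x : World k) → ∃ λ i → bot i ⊑ x
  botBelow (top i) = let j , j≢i , _ = avoid i i in j , edge j≢i
  botBelow (bot i) = i , ⊑-refl

  swap : World k → World k
  swap (top i) = bot i
  swap (bot i) = top i

  swap-involutive : ∀ x → swap (swap x) ≡ x
  swap-involutive (top i) = refl
  swap-involutive (bot i) = refl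

  swap-antitone : ∀ {x y} → x ⊑ y → swap y ⊑ swap x
  swap-antitone ⊑-refl   = ⊑-refl
  swap-antitone (edge n) = edge (n ∘ sym)

-- Soundness of the two logics on crowns

module Classical (em : ExcludedMiddle 0ℓ) where

  private
    stable : DoubleNegationElimination 0ℓ
    stable = em⇒dne em

  ¬×⇒⊎ : ∀ {P Q : Set} → ¬ (P × Q) → ¬ P ⊎ ¬ Q
  ¬×⇒⊎ {P} n with em {P}
  ... | yes p = inj₂ λ q → n (p , q)
  ... | no ¬p = inj₁ ¬p

  -- `neg P` is the upward closure of the complement of P, the least upset that together with P
  -- covers the frame.
  dualPseudocomplement : ∀ k → Negation (_⊑_ {k})
  dualPseudocomplement k = record
    { neg        = λ P x → ∃ λ y → y ⊑ x × ¬ P y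
    ; antitone   = λ P⊆Q (y , p , n) → y , p , n ∘ P⊆Q
    ; persistent = λ _ q (y , p , n) → y , ⊑-trans p q , n
    ; neg-∅      = _ , ⊑-refl , id
    ; neg-U      = λ (_ , _ , n) → n tt
    ; neg-∩      = λ (y , p , n) → map-⊎ (λ m → y , p , m) (λ m → y , p , m) (¬×⇒⊎ n)
    }

  deMorgan : ∀ k → Negation (_⊑_ {k})
  deMorgan k = record
    { neg        = λ P x → ¬ P (swap x)
    ; antitone   = λ P⊆Q n p → n (P⊆Q p)
    ; persistent = λ up p n a → n (up (swap-antitone p) a)
    ; neg-∅      = id
    ; neg-U      = λ n → n tt
    ; neg-∩      = ¬×⇒⊎
    }

  -- A proper inclusion y ⊑ x makes x maximal, which is why both regularity axioms hold on crowns.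
  regular : ∀ {k} {x y : World k} {P : World k → Set} → y ⊑ x → P x → ¬ P y →
            ∀ (Q : World k → Set) → Q x ⊎ (∀ {z} → x ⊑ z → Q z → Empty)
  regular ⊑-refl   p n Q = contradiction p n
  regular (edge {j = j} _) p n Q with em {Q (top j)}
  ... | yes q = inj₁ q
  ... | no ¬q = inj₂ λ { ⊑-refl → ¬q }

  RDPCH-sound : ∀ {k} → let open Kripke ⊑-refl ⊑-trans (dualPseudocomplement k) in
                ∀ {v} (up : Persistent v) → All (InstancesHold up) RDPCH-axioms
  RDPCH-sound {k} {v} up =
      (λ σ p → proj₁)
    ∷ (λ σ p n → n , tt)
    ∷ (λ σ →
        (λ p (y , q , n) → (y , q , n) ,
          -- Since `bot i` is minimal, whichever disjunct holds there holds at everything below it.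
          let i , r = botBelow y in
          map-⊎ (λ a → bot i , ⊑-trans r q , λ { (_ , ⊑-refl , m) → m a })
                (λ b → bot i , ⊑-trans r q , λ { (_ , ⊑-refl , m) → m b })
                (stable λ m → n (bot i , r , m))) ,
        (λ p a → a , [ (λ (y , q , n) → y , q , λ (z , r , m) → n (z , r , m ∘ inj₁))
                     , (λ (y , q , n) → y , q , λ (z , r , m) → n (z , r , m ∘ inj₂)) ]′ a))
    ∷ (λ σ →
        (λ p a → a , [ (λ (y , q , n) → persistent up (σ 0) q (stable λ m → n (y , ⊑-refl , m)))
                     , id ]′ a) ,
        (λ p a → a , inj₂ a))
    ∷ (λ σ {x} → excludedMiddle (⟦ σ 0 ⟧ v) x)
    ∷ (λ σ →
        (λ p a → a , [ (λ (b , y , q , n) → regular {P = ⟦ σ 0 ⟧ v} q b n (⟦ σ 1 ⟧ v)) , id ]′ a) ,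
        (λ p a → a , inj₂ a))
    ∷ []
    where
    open Kripke ⊑-refl ⊑-trans (dualPseudocomplement k)

    excludedMiddle : ∀ (P : World k → Set) x → P x ⊎ (∃ λ y → y ⊑ x × ¬ P y)
    excludedMiddle P x with em {P x}
    ... | yes p = inj₁ p
    ... | no ¬p = inj₂ (x , ⊑-refl , ¬p)

  -- In RDMH the dual pseudocomplement is the term ∼((∼φ)*).
  ∼∼* : ∀ {k} → let open Kripke ⊑-refl ⊑-trans (deMorgan k) in
        ∀ φ {v x} → ⟦ ∼ ((∼ φ) *) ⟧ v x ⇔ ∃ λ y → y ⊑ x × ¬ ⟦ φ ⟧ v y
  ∼∼* {k} φ {v} {x} = mk⇔
    (λ n → stable λ m → n λ {z} p r →
      m (swap z , subst (swap z ⊑_) (swap-involutive x) (swap-antitone p) , r))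
    (λ (y , p , n) h → h (swap-antitone p) (subst (λ z → ¬ ⟦ φ ⟧ v z) (sym (swap-involutive y)) n))
    where
    open Kripke ⊑-refl ⊑-trans (deMorgan k)

  RDMH-sound : ∀ {k} → let open Kripke ⊑-refl ⊑-trans (deMorgan k) in
               ∀ {v} (up : Persistent v) → All (InstancesHold up) RDMH-axioms
  RDMH-sound {k} {v} up =
      (λ σ p → proj₁)
    ∷ (λ σ →
        (λ {y} p a → a , subst (⟦ σ 0 ⟧ v) (swap-involutive _) (stable a)) ,
        (λ {y} p a → a , λ n → n (subst (⟦ σ 0 ⟧ v) (sym (swap-involutive _)) a)))
    ∷ (λ σ →
        (λ p a → a , [ (λ (b , n) → let _ , q , m = to (∼∼* (σ 0)) n in
                          regular {P = ⟦ σ 0 ⟧ v} q b m (⟦ σ 1 ⟧ v))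
                     , id ]′ a) ,
        (λ p a → a , inj₂ a))
    ∷ []
    where
    open Kripke ⊑-refl ⊑-trans (deMorgan k)

-- Characteristic formulas of crowns

⋁ ⋀ : ∀ {n} → (Fin n → Formula right) → Formula right
⋁ {zero}   f = ⊥
⋁ {nsuc n} f = f zero ∨ ⋁ (f ∘ fsuc)
⋀ {zero}   f = ⊤
⋀ {nsuc n} f = f zero ∧ ⋀ (f ∘ fsuc)

-- `d` stands for a term defining the dual pseudocomplement, so that one construction serves both
-- choices of `∼`.
module Characteristic (em : ExcludedMiddle 0ℓ) (N : ∀ k → Negation (_⊑_ {k}))
                      (d : Formula right → Formula right) where

  open module K {k} = Kripke {_⊑_ = _⊑_ {k}} ⊑-refl ⊑-trans (N k)

  private
    stable : DoubleNegationElimination 0ℓ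
    stable = em⇒dne em

  -- Holds at a top element t when everything below t satisfies the variable j; in the refuting
  -- valuation, where the variable j fails at bot j only, this says t = top j.
  point : ℕ → Formula right
  point j = d (var j) *

  -- `d (φ *)` steps down from a top and up again. As any two tops have a common lower bound, at a
  -- top it says that φ holds at some top.
  isPoint inhabited : ∀ {n} → Fin n → Formula right
  isPoint j   = point (toℕ j)
  inhabited j = d (isPoint j *)

  apart : ∀ {n} → Fin (nsuc n) → Fin n → Formula right
  apart i j = (isPoint i ∧ isPoint (punchIn i j)) *

  points : ℕ → Formula right
  points n = ⋁ {3 + n} isPoint ∧ ⋀ {3 + n} inhabited ∧ ⋀ {3 + n} (λ i → ⋀ (apart i))

  -- At a top, `d (φ * *)` fails exactly when φ holds at every top, so this denies that `points n`
  -- holds at all tops; the outer double `*` makes truth depend on tops only.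
  characteristic : ℕ → Formula right
  characteristic n = d (points n * *) * *

  module _ {k} {v : ℕ → World k → Set} where

    ⟦⋁⟧ : ∀ {n} (f : Fin n → Formula right) {x} → ⟦ ⋁ f ⟧ v x ⇔ ∃ λ i → ⟦ f i ⟧ v x
    ⟦⋁⟧ {zero}   f = mk⇔ (λ ()) (λ ())
    ⟦⋁⟧ {nsuc n} f = mk⇔
      [ (λ p → zero , p) , (λ p → let i , q = to (⟦⋁⟧ (f ∘ fsuc)) p in fsuc i , q) ]′
      λ { (zero , p) → inj₁ p ; (fsuc i , p) → inj₂ (from (⟦⋁⟧ (f ∘ fsuc)) (i , p)) }

    ⟦⋀⟧ : ∀ {n} (f : Fin n → Formula right) {x} → ⟦ ⋀ f ⟧ v x ⇔ (∀ i → ⟦ f i ⟧ v x)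
    ⟦⋀⟧ {zero}   f = mk⇔ (λ _ ()) _
    ⟦⋀⟧ {nsuc n} f = mk⇔
      (λ { (p , q) zero → p ; (p , q) (fsuc i) → to (⟦⋀⟧ (f ∘ fsuc)) q i })
      λ h → h zero , from (⟦⋀⟧ (f ∘ fsuc)) (h ∘ fsuc)

    ⟦*⟧-top : ∀ φ {t} → ⟦ φ * ⟧ v (top t) ⇔ (¬ ⟦ φ ⟧ v (top t))
    ⟦*⟧-top φ = mk⇔ (λ h → h ⊑-refl) λ { n ⊑-refl → n }

  Point : ∀ {k} → (ℕ → World k → Set) → ℕ → Fin (3 + k) → Set
  Point v j t = ∀ x → x ⊑ top t → v j x

  record Points {k} (v : ℕ → World k → Set) (n : ℕ) : Set where
    field
      cover    : ∀ t → ∃ λ (j : Fin (3 + n)) → Point v (toℕ j) t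
      inhabit  : ∀ (j : Fin (3 + n)) → ∃ λ t → Point v (toℕ j) t
      disjoint : ∀ {i j : Fin (3 + n)} → i ≢ j → ∀ {t} → Point v (toℕ i) t → ¬ Point v (toℕ j) t

  module _ (⟦d⟧ : ∀ {k} φ {v} {x : World k} → ⟦ d φ ⟧ v x ⇔ ∃ λ y → y ⊑ x × ¬ ⟦ φ ⟧ v y) where

    module _ {k} {v : ℕ → World k → Set} where

      ⟦point⟧ : ∀ j {t} → ⟦ point j ⟧ v (top t) ⇔ Point v j t
      ⟦point⟧ j = mk⇔
        (λ h _ p → stable λ n → h ⊑-refl (from (⟦d⟧ (var j)) (_ , p , n)))
        λ { h ⊑-refl e → let y , p , n = to (⟦d⟧ (var j)) e in n (h y p) }

      -- If φ failed at `top s`, then `φ * *` would fail at a common lower bound of `top s` and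
      -- `top t`.
      d**-everywhere : ∀ φ {t} → ¬ ⟦ d (φ * *) ⟧ v (top t) → ∀ s → ⟦ φ ⟧ v (top s)
      d**-everywhere φ {t} h s = stable λ n →
        let i , i≢t , i≢s = avoid t s in
        h (from (⟦d⟧ (φ * *)) (bot i , edge i≢t , λ e → e (edge i≢s) (from (⟦*⟧-top φ) n)))

      d**-nowhere : ∀ φ → (∀ s → ⟦ φ ⟧ v (top s)) → ∀ {x} → ¬ ⟦ d (φ * *) ⟧ v x
      d**-nowhere φ h e = let _ , _ , n = to (⟦d⟧ (φ * *)) e in
        n λ {y} _ m → let s , p = topAbove y in m p (h s)

      ⟦points⟧⇒ : Persistent v → ∀ n → (∀ t → ⟦ points n ⟧ v (top t)) → Points v n
      ⟦points⟧⇒ up n h = record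
        { cover    = λ t → let j , p = to (⟦⋁⟧ {v = v} isPoint) (proj₁ (h t)) in
                           j , to (⟦point⟧ (toℕ j)) p
        ; inhabit  = λ j →
            -- The choice of `top zero` is arbitrary, as `inhabited j` says the same at every top. A
            -- world where `isPoint j` holds is then replaced by a top above it.
            let y , _ , m = to (⟦d⟧ (isPoint j *))
                              (to (⟦⋀⟧ {v = v} inhabited) (proj₁ (proj₂ (h zero))) j)
            in stable λ e → m λ {x} _ p →
              let s , x⊑s = topAbove x in
              e (s , to (⟦point⟧ (toℕ j)) (persistent up (isPoint j) x⊑s p))
        ; disjoint = λ {i} {j} i≢j {t} p q →
            to (⟦⋀⟧ {v = v} (apart i))
              (to (⟦⋀⟧ {v = v} (λ l → ⋀ (apart l))) (proj₂ (proj₂ (h t))) i)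
              (punchOut i≢j) ⊑-refl
              ( from (⟦point⟧ (toℕ i)) p
              , subst (λ l → ⟦ isPoint l ⟧ v (top t)) (sym (punchIn-punchOut i≢j))
                  (from (⟦point⟧ (toℕ j)) q))
        }

      ⟦points⟧⇐ : ∀ n → Points v n → ∀ t → ⟦ points n ⟧ v (top t)
      ⟦points⟧⇐ n P t =
          (let j , p = cover t in from (⟦⋁⟧ {v = v} isPoint) (j , from (⟦point⟧ (toℕ j)) p))
        , from (⟦⋀⟧ {v = v} inhabited) (λ j →
            let s , p = inhabit j
                i , i≢s , i≢t = avoid s t
            in from (⟦d⟧ (isPoint j *))
                 (bot i , edge i≢t , λ m → m (edge i≢s) (from (⟦point⟧ (toℕ j)) p)))
        , from (⟦⋀⟧ {v = v} (λ l → ⋀ (apart l))) (λ i → from (⟦⋀⟧ {v = v} (apart i)) λ j →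
            λ { ⊑-refl (p , q) → disjoint (punchInᵢ≢i i j ∘ sym)
                  (to (⟦point⟧ (toℕ i)) p) (to (⟦point⟧ (toℕ (punchIn i j))) q) })
        where open Points P

      -- A variable holding below two top elements holds at every world, so each point is a
      -- single top element and t ↦ its point is a bijection Fin (3 + k) → Fin (3 + n).
      Points⇒≡ : Persistent v → ∀ n → Points v n → k ≡ n
      Points⇒≡ up n P =
        +-cancelˡ-≡ 3 _ _ (≤-antisym (injective⇒≤ f-injective) (injective⇒≤ g-injective))
        where
        open Points P

        f : Fin (3 + k) → Fin (3 + n)
        f t = proj₁ (cover t)

        g : Fin (3 + n) → Fin (3 + k)
        g j = proj₁ (inhabit j)

        g-injective : ∀ {i j} → g i ≡ g j → i ≡ j
        g-injective {i} {j} e with i ≟ᶠ j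
        ... | yes i≡j = i≡j
        ... | no i≢j  = contradiction (proj₂ (inhabit j))
          (disjoint i≢j (subst (Point v (toℕ i)) e (proj₂ (inhabit i))))

        everywhere : ∀ {j s t} → s ≢ t → Point v j s → Point v j t → ∀ x → v j x
        everywhere {j} {s} {t} s≢t p q (bot i) with i ≟ᶠ s
        ... | yes refl = q _ (edge s≢t)
        ... | no i≢s   = p _ (edge i≢s)
        everywhere {j} s≢t p q (top i) =
          let l , l⊑i = botBelow (top i) in up j l⊑i (everywhere s≢t p q (bot l))

        single : ∀ (j : Fin (3 + n)) {s t} → Point v (toℕ j) s → Point v (toℕ j) t → s ≡ t
        single j {s} {t} p q with s ≟ᶠ t
        ... | yes s≡t = s≡t
        ... | no s≢t  =
          -- The variable j now holds at every world, hence below the top belonging to another index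
          -- i, against `disjoint`.
          let i , i≢j , _ = avoid j j
              _ , r = inhabit i
          in contradiction (λ x _ → everywhere {toℕ j} s≢t p q x) (disjoint i≢j r)

        f-injective : ∀ {s t} → f s ≡ f t → s ≡ t
        f-injective {s} {t} e = single (f t)
          (subst (λ j → Point v (toℕ j) s) e (proj₂ (cover s))) (proj₂ (cover t))

      characteristic-valid : Persistent v → ∀ {n} → k ≢ n → ∀ {x} → ⟦ characteristic n ⟧ v x
      characteristic-valid up {n} k≢n {x} {y} _ h =
        let t , p = topAbove y in
        k≢n (Points⇒≡ up n (⟦points⟧⇒ up n (d**-everywhere (points n) {t} (h p))))

    separating : ∀ {k} → ℕ → World k → Set
    separating j (top _) = Unit
    separating j (bot i) = toℕ i ≢ j

    separating-persistent : ∀ {k} → Persistent (separating {k})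
    separating-persistent j ⊑-refl   a = a
    separating-persistent j (edge _) _ = tt

    separating-points : ∀ n → Points (separating {n}) n
    separating-points n = record
      { cover    = λ t → t , at t
      ; inhabit  = λ t → t , at t
      ; disjoint = disjoint
      }
      where
      at : ∀ t → Point separating (toℕ t) t
      at t _ ⊑-refl     = tt
      at t _ (edge i≢t) = i≢t ∘ toℕ-injective

      disjoint : ∀ {i j : Fin (3 + n)} → i ≢ j → ∀ {t} →
                 Point separating (toℕ i) t → ¬ Point separating (toℕ j) t
      disjoint {i} {j} i≢j {t} p q with i ≟ᶠ t
      -- If i differs from t, then `bot i` is below `top t` and lacks the variable i; otherwise j
      -- differs from t and `bot j` plays this role.
      ... | no i≢t   = p _ (edge i≢t) refl
      ... | yes refl = q _ (edge (i≢j ∘ sym)) refl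

    characteristic-refuted : ∀ n → ¬ ⟦ characteristic n ⟧ (separating {n}) (top zero)
    characteristic-refuted n h = h ⊑-refl
      λ _ → d**-nowhere (points n) (⟦points⟧⇐ n (separating-points n))

    -- If X omits m, the m-th crown under `separating` satisfies all instances of the selected
    -- axioms, whose indices differ from m, but refutes `characteristic m`.
    characteristic-independent : (em₁ : ExcludedMiddle (suc 0ℓ)) {A : Pred (Formula right) 0ℓ} →
      (∀ {k v} (up : Persistent {k} v) {φ} → φ ∈ A → InstancesHold up φ) →
      Independent em₁ {S = DHMSH ⊕ A} characteristic
    characteristic-independent em₁ {A} hA X m thm with X m in eq
    ... | true  = refl
    ... | false = ⊥-elim (characteristic-refuted m
      (sound separating-persistent (hA separating-persistent) selected-hold thm))
      where
      selected-hold : ∀ {φ} → φ ∈ selected em₁ {S = DHMSH ⊕ A} characteristic X →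
                      InstancesHold {m} separating-persistent φ
      -- An instance under `σ` is the formula itself under another persistent valuation, which
      -- `characteristic-valid` also covers.
      selected-hold (n , t , refl) σ = from (⟦[]⟧ (characteristic n) σ {separating})
        (characteristic-valid (λ j → persistent separating-persistent (σ j))
          λ { refl → contradiction (trans (sym t) eq) λ () })

-- Cardinality of the three lattices of extensions

corollary3p15 : ExcludedMiddle (suc 0ℓ) →
    Bijection (Lattice.setoid (Ext RDPCH)) (ℕ →-setoid Bool)
    × Bijection (Lattice.setoid (Ext RPCHᵈ)) (ℕ →-setoid Bool)
    × Bijection (Lattice.setoid (Ext RDMH)) (ℕ →-setoid Bool)
corollary3p15 em =
    independent⇒continuum em P.characteristic P-independent
  , independent⇒continuum em (dual ∘ P.characteristic)
      (dual-independent em {χ = P.characteristic} P-independent)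
  , independent⇒continuum em M.characteristic
      (M.characteristic-independent ∼∼* em λ up p → lookup (RDMH-sound up) p)
  where
  em₀ : ExcludedMiddle 0ℓ
  em₀ = lowerEM (suc 0ℓ) em

  open Classical em₀

  module P = Characteristic em₀ dualPseudocomplement ∼_
  module M = Characteristic em₀ deMorgan (λ φ → ∼ ((∼ φ) *))

  P-independent : Independent em {S = RDPCH} P.characteristic
  P-independent = P.characteristic-independent (λ φ → mk⇔ id id) em
    λ up p → lookup (RDPCH-sound up) p
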